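{- There exist an $\mathcal{L}^{2- }$-sentence $\varphi'$ and a positive conjunctive query $\psi(\bar{y})$ such that the query answering problem $\mathcal{Q}_{\varphi',\psi(\bar{y})}$ is undecidable. Likewise, there exist an $\mathcal{L}^{2- }$-sentence $\varphi'$ and a positive conjunctive query $\psi(\bar{y})$ such that the finite query answering problem $\mathcal{FQ}_{\varphi',\psi(\bar{y})}$ is undecidable.
   Context: $\mathcal{L}^{2- }$ is the set of first-order formulas over a relational signature of unary and binary predicates (no constants, no function symbols) using only the variables $x$ and $y$, containing no counting quantifiers and no occurrence of equality. A positive conjunctive query is a formula $\psi(\bar{y})$ of the form $\exists\bar{x}(\alpha_1\wedge\cdots\wedge\alpha_n)$, $n\geq 1$, where each $\alpha_i$ is an atomic formula with a unary or binary predicate other than $\approx$ whose arguments are variables from $\bar{x},\bar{y}$ (the tuples may be empty; no constants). For a sentence $\varphi$ and such $\psi(\bar{y})$: $\mathcal{Q}_{\varphi,\psi(\bar{y})}$ is the problem: given a finite set $\Delta$ of ground, function-free literals and a tuple $\bar{a}$ of individual constants of the same arity as $\bar{y}$, decide whether $\Delta\cup\{\varphi\}\models\psi(\bar{a})$. $\mathcal{FQ}_{\varphi,\psi(\bar{y})}$ is the problem: given such $\Delta,\bar{a}$, decide whether $\psi(\bar{a})$ is true in every finite model of $\Delta\cup\{\varphi\}$. -}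

module Defs where

open import Level using (Level; 0ℓ) renaming (suc to lsuc)
open import Data.Nat using (ℕ; zero; suc; _+_; _<_)
open import Data.Fin using (Fin)
open import Data.Vec using (Vec; []; _∷_; lookup)
open import Data.List using (List; []; _∷_)
open import Data.List.Relation.Unary.All using (All)
open import Data.Bool using (Bool; true; false; T; _∧_; _∨_; if_then_else_)
open import Data.Product using (Σ; _×_; _,_)
open import Data.Sum using (_⊎_)
open import Data.Empty using (⊥)
open import Relation.Nullary using (¬_)

data Var2 : Set where
  vx vy : Var2

_==_ : Var2 → Var2 → Bool
vx == vx = true
vy == vy = true
_  == _  = false

-- Formulas of L^{2-}: only variables x,y; no equality, no counting
-- quantifiers, no constants, no function symbols.
data Fml : Set where
  un   : ℕ → Var2 → Fml
  bin  : ℕ → Var2 → Var2 → Fml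
  tt ff : Fml
  neg  : Fml → Fml
  conj disj impl : Fml → Fml → Fml
  all ex : Var2 → Fml → Fml

closedUnder : (Var2 → Bool) → Fml → Bool
closedUnder b (un _ v)     = b v
closedUnder b (bin _ v w)  = b v ∧ b w
closedUnder b tt           = true
closedUnder b ff           = true
closedUnder b (neg φ)      = closedUnder b φ
closedUnder b (conj φ ψ)   = closedUnder b φ ∧ closedUnder b ψ
closedUnder b (disj φ ψ)   = closedUnder b φ ∧ closedUnder b ψ
closedUnder b (impl φ ψ)   = closedUnder b φ ∧ closedUnder b ψ
closedUnder b (all v φ)    = closedUnder (λ w → (w == v) ∨ b w) φ
closedUnder b (ex v φ)     = closedUnder (λ w → (w == v) ∨ b w) φ

IsSentence : Fml → Set
IsSentence φ = T (closedUnder (λ _ → false) φ)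

-- Structures (nonempty domain; relations given as characteristic
-- functions, which classically is no restriction).

record Structure : Set₁ where
  field
    D  : Set
    pt : D
    U  : ℕ → D → Bool
    B  : ℕ → D → D → Bool
    c  : ℕ → D
open Structure public

-- Finite structures: domain Fin (suc n) (every finite model is
-- isomorphic to one of these).
record FinStructure (n : ℕ) : Set where
  field
    U  : ℕ → Fin (suc n) → Bool
    B  : ℕ → Fin (suc n) → Fin (suc n) → Bool
    c  : ℕ → Fin (suc n)

toStructure : ∀ {n} → FinStructure n → Structure
toStructure {n} F = record
  { D = Fin (suc n) ; pt = Fin.zero
  ; U = FinStructure.U F ; B = FinStructure.B F ; c = FinStructure.c F }

update : {D : Set} → (Var2 → D) → Var2 → D → Var2 → D
update ρ v d w = if w == v then d else ρ w

-- Classical (Tarskian) satisfaction, via the stable (double negation)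
-- reading of ∨ and ∃.
Sat : (M : Structure) → (Var2 → D M) → Fml → Set
Sat M ρ (un p v)    = T (U M p (ρ v))
Sat M ρ (bin p v w) = T (B M p (ρ v) (ρ w))
Sat M ρ tt          = ⊥ → ⊥
Sat M ρ ff          = ⊥
Sat M ρ (neg φ)     = ¬ Sat M ρ φ
Sat M ρ (conj φ ψ)  = Sat M ρ φ × Sat M ρ ψ
Sat M ρ (disj φ ψ)  = ¬ (¬ Sat M ρ φ × ¬ Sat M ρ ψ)
Sat M ρ (impl φ ψ)  = Sat M ρ φ → Sat M ρ ψ
Sat M ρ (all v φ)   = (d : D M) → Sat M (update ρ v d) φ
Sat M ρ (ex v φ)    = ¬ ((d : D M) → ¬ Sat M (update ρ v d) φ)

_⊨_ : Structure → Fml → Set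
M ⊨ φ = Sat M (λ _ → pt M) φ

data Lit : Set where
  posU negU : ℕ → ℕ → Lit
  posB negB : ℕ → ℕ → ℕ → Lit

SatLit : (M : Structure) → Lit → Set
SatLit M (posU p a)   = T (U M p (c M a))
SatLit M (negU p a)   = ¬ T (U M p (c M a))
SatLit M (posB p a b) = T (B M p (c M a) (c M b))
SatLit M (negB p a b) = ¬ T (B M p (c M a) (c M b))

_⊨Δ_ : Structure → List Lit → Set
M ⊨Δ Δ = All (SatLit M) Δ

-- Positive conjunctive queries ψ(ȳ) = ∃x̄ (α₁ ∧ … ∧ αₙ), n ≥ 1,
-- with |ȳ| = k answer variables and |x̄| = m quantified variables.

data QVar (m k : ℕ) : Set where
  qx : Fin m → QVar m k
  qy : Fin k → QVar m k

data QAtom (m k : ℕ) : Set where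
  qun  : ℕ → QVar m k → QAtom m k
  qbin : ℕ → QVar m k → QVar m k → QAtom m k

record CQ (k : ℕ) : Set where
  constructor mkCQ
  field
    m      : ℕ
    first  : QAtom m k
    others : List (QAtom m k)
open CQ public

SatQAtom : (M : Structure) {m k : ℕ} → (QVar m k → D M) → QAtom m k → Set
SatQAtom M ν (qun p v)    = T (U M p (ν v))
SatQAtom M ν (qbin p v w) = T (B M p (ν v) (ν w))

valQ : (M : Structure) {m k : ℕ} → (Fin m → D M) → Vec ℕ k → QVar m k → D M
valQ M e ā (qx i) = e i
valQ M e ā (qy j) = c M (lookup ā j)

-- M ⊨ ψ(ā)   (∃ read classically, i.e. as ¬¬∃)
SatCQ : (M : Structure) {k : ℕ} → CQ k → Vec ℕ k → Set
SatCQ M ψ ā = ¬ ¬ Σ (Fin (m ψ) → D M) λ e →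
  SatQAtom M (valQ M e ā) (first ψ) × All (SatQAtom M (valQ M e ā)) (others ψ)

Instance : ℕ → Set
Instance k = List Lit × Vec ℕ k

Qprob : Fml → {k : ℕ} → CQ k → Instance k → Set₁
Qprob φ ψ (Δ , ā) = (M : Structure) → M ⊨Δ Δ → M ⊨ φ → SatCQ M ψ ā

FQprob : Fml → {k : ℕ} → CQ k → Instance k → Set
FQprob φ ψ (Δ , ā) = (n : ℕ) (F : FinStructure n) →
  toStructure F ⊨Δ Δ → toStructure F ⊨ φ → SatCQ (toStructure F) ψ ā

data PRF : ℕ → Set where
  Z    : ∀ {n} → PRF n
  S    : PRF 1
  P    : ∀ {n} → Fin n → PRF n
  Comp : ∀ {n m} → PRF m → Vec (PRF n) m → PRF n
  Rec  : ∀ {n} → PRF n → PRF (suc (suc n)) → PRF (suc n)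
  Min  : ∀ {n} → PRF (suc n) → PRF n

data _[_]⇓_ : ∀ {n} → PRF n → Vec ℕ n → ℕ → Set
data _[_]⇓*_ : ∀ {n m} → Vec (PRF n) m → Vec ℕ n → Vec ℕ m → Set

data _[_]⇓_ where
  ⇓Z    : ∀ {n} {xs : Vec ℕ n} → Z [ xs ]⇓ 0
  ⇓S    : ∀ {x} → S [ x ∷ [] ]⇓ suc x
  ⇓P    : ∀ {n} {i : Fin n} {xs} → P i [ xs ]⇓ lookup xs i
  ⇓Comp : ∀ {n m} {f : PRF m} {gs : Vec (PRF n) m} {xs ys y} →
          gs [ xs ]⇓* ys → f [ ys ]⇓ y → Comp f gs [ xs ]⇓ y
  ⇓Rec0 : ∀ {n} {f : PRF n} {g xs y} →
          f [ xs ]⇓ y → Rec f g [ 0 ∷ xs ]⇓ y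
  ⇓RecS : ∀ {n} {f : PRF n} {g xs k r y} →
          Rec f g [ k ∷ xs ]⇓ r → g [ k ∷ r ∷ xs ]⇓ y →
          Rec f g [ suc k ∷ xs ]⇓ y
  ⇓Min  : ∀ {n} {f : PRF (suc n)} {xs k} →
          f [ k ∷ xs ]⇓ 0 →
          (∀ j → j < k → Σ ℕ λ v → f [ j ∷ xs ]⇓ suc v) →
          Min f [ xs ]⇓ k

data _[_]⇓*_ where
  []  : ∀ {n} {xs : Vec ℕ n} → [] [ xs ]⇓* []
  _∷_ : ∀ {n m} {g : PRF n} {gs : Vec (PRF n) m} {xs y ys} →
        g [ xs ]⇓ y → gs [ xs ]⇓* ys → (g ∷ gs) [ xs ]⇓* (y ∷ ys)

-- Gödel coding of instances (Cantor pairing).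

tri : ℕ → ℕ
tri zero    = zero
tri (suc n) = suc n + tri n

pair : ℕ → ℕ → ℕ
pair a b = tri (a + b) + b

codeList : {A : Set} → (A → ℕ) → List A → ℕ
codeList f []       = 0
codeList f (x ∷ xs) = suc (pair (f x) (codeList f xs))

codeVec : ∀ {k} → Vec ℕ k → ℕ
codeVec []       = 0
codeVec (x ∷ xs) = suc (pair x (codeVec xs))

codeLit : Lit → ℕ
codeLit (posU p a)   = pair 0 (pair p a)
codeLit (negU p a)   = pair 1 (pair p a)
codeLit (posB p a b) = pair 2 (pair p (pair a b))
codeLit (negB p a b) = pair 3 (pair p (pair a b))

codeInstance : ∀ {k} → Instance k → ℕ
codeInstance (Δ , ā) = pair (codeList codeLit Δ) (codeVec ā)

Decidable : ∀ {ℓ k} → (Instance k → Set ℓ) → Set ℓ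
Decidable {ℓ} {k} Pr = Σ (PRF 1) λ f → (I : Instance k) →
  (f [ codeInstance I ∷ [] ]⇓ 1 × Pr I) ⊎ (f [ codeInstance I ∷ [] ]⇓ 0 × ¬ Pr I)

Undecidable : ∀ {ℓ k} → (Instance k → Set ℓ) → Set ℓ
Undecidable Pr = ¬ Decidable Pr

{-# OPTIONS --safe #-}
-- A fixed pointer machine evaluates partial recursive functions: its memory
-- consists of records with three fields, every step creates one record whose
-- fields are copied along paths from the old one, and the program is data.
-- The constants of Δ describe the initial record, φ demands a successor of
-- every record that can make a step, and forbids halting with result 0. The
-- rules that say what the fields of the successor are have three variables;
-- their violations form the query ψ. So if F(n) = 0, every model of Δ and φ
-- satisfies ψ, while if F(n) = 1, the records of the finite run form a finite
-- model without ψ. A decider of either problem would separate these two cases,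
-- which is impossible by diagonalization; no universal function is needed,
-- since Δ contains the program and the input is the code of those facts.
module Submission where

open import Defs
open import Data.Nat using (ℕ)
open import Data.Product using (Σ; _×_)
open import Data.Bool using (Bool; true; false; T; _∧_; _∨_; not; if_then_else_)
open import Data.Bool.Properties using (T?)
open import Data.Empty using (⊥; ⊥-elim)
open import Data.Fin using (Fin; zero; suc; toℕ; combine; remQuot; _≟_)
open import Data.Fin.Properties using (remQuot-combine; toℕ-injective)
open import Data.List using (List; []; _∷_; _++_; concat; concatMap; length; tabulate; lookup; allFin; map)
open import Data.List.Membership.Propositional using (_∈_; lose)
open import Data.List.Membership.Propositional.Properties using (∈-allFin; ∈-concatMap⁺; ∈-lookup; ∈-++⁺ˡ; ∈-++⁺ʳ; ∈-++⁻; ∈-map⁺; ∈-map⁻)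
open import Data.List.Relation.Unary.All as All using (All; []; _∷_)
open import Data.List.Relation.Unary.All.Properties using (concat⁺; concat⁻; tabulate⁺; tabulate⁻; ++⁺; ++⁻ˡ; ++⁻ʳ)
open import Data.List.Relation.Unary.Any using (here; there; index)
open import Data.List.Relation.Unary.Any.Properties using (lookup-index)
open import Data.Maybe using (Maybe; just; nothing)
open import Data.Nat as ℕ using (zero; suc; _+_; _*_; _<_; _≡ᵇ_)
open import Data.Nat.Properties using (+-suc; +-identityʳ; <-trans; n<1+n; ≡ᵇ⇒≡; ≡⇒≡ᵇ)
open import Data.Product using (_,_; proj₁; proj₂)
open import Data.Sum using (_⊎_; inj₁; inj₂; [_,_]′)
open import Data.Unit using (⊤; tt)
open import Data.Vec as Vec using (Vec; []; _∷_)
open import Function using (id; _∘_)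
open import Relation.Binary.Construct.Closure.ReflexiveTransitive using (Star; ε; _◅_; _◅◅_)
open import Relation.Binary.PropositionalEquality using (_≡_; _≢_; refl; sym; trans; cong; subst; subst₂)
open import Relation.Nullary using (¬_; Dec; yes; no)
open import Relation.Nullary.Decidable using (decidable-stable; ⌊_⌋; toWitness; fromWitness; map′; _×-dec_)

-- Records as terms, paths into them, and the pointer machine.

data Field : Set where
  cd vl kt : Field

data Path : Set where
  []  : Path
  _▹_ : Path → Field → Path

infixl 6 _▹_

data Tm : Set where
  lf : Tm
  nd : ℕ → (c v k : Tm) → Tm

-- The default `lf` makes `at` total. In an arbitrary model `lf` will demand nothing; in the
-- countermodel it is an element without label.
fld : Tm → Field → Tm
fld lf           _  = lf
fld (nd _ c _ _) cd = c
fld (nd _ _ v _) vl = v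
fld (nd _ _ _ k) kt = k

at : Path → Tm → Tm
at []      t = t
at (p ▹ j) t = fld (at p t) j

hasLab : ℕ → Tm → Bool
hasLab _ lf            = false
hasLab l (nd l' _ _ _) = l ≡ᵇ l'

-- Two labels do double duty: `CFG` marks machine records and successors, `NIL` marks an instruction
-- and the number zero. Hence records and instruction cells can serve as numbers.
pattern CFG   = 0
pattern NIL   = 1
pattern WRAP  = 2
pattern FST   = 3
pattern SND   = 4
pattern PUSH  = 5
pattern SWAP  = 6
pattern CONS  = 7
pattern LOOP  = 8
pattern EXIT  = 9
pattern AGAIN = 10
pattern BR    = 11
pattern HALT  = 12

data Kind : Set where
  nilK wrapK fstK sndK pushK swapK consK loopK exitK againK brzK brsK : Kind

opLab : Kind → ℕ
opLab nilK   = NIL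
opLab wrapK  = WRAP
opLab fstK   = FST
opLab sndK   = SND
opLab pushK  = PUSH
opLab swapK  = SWAP
opLab consK  = CONS
opLab loopK  = LOOP
opLab exitK  = EXIT
opLab againK = AGAIN
opLab brzK   = BR
opLab brsK   = BR

valLab : Kind → Maybe ℕ
valLab brzK = just NIL
valLab brsK = just CFG
valLab _    = nothing

-- The old record itself (path []) serves as stack cell, as pair and as
-- successor: the pair it stands for has second component vl and first
-- component kt.vl, and the number it stands for is the successor of vl.
-- In a code cell, vl is the next instruction and kt the body of a loop or
-- the second branch.
table : Kind → Field → Path
table nilK   cd = [] ▹ cd ▹ vl
table nilK   vl = [] ▹ cd
table nilK   kt = [] ▹ kt
table wrapK  cd = [] ▹ cd ▹ vl
table wrapK  vl = []
table wrapK  kt = [] ▹ kt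
table fstK   cd = [] ▹ cd ▹ vl
table fstK   vl = [] ▹ vl ▹ kt ▹ vl
table fstK   kt = [] ▹ kt
table sndK   cd = [] ▹ cd ▹ vl
table sndK   vl = [] ▹ vl ▹ vl
table sndK   kt = [] ▹ kt
table pushK  cd = [] ▹ cd ▹ vl
table pushK  vl = [] ▹ vl
table pushK  kt = []
table swapK  cd = [] ▹ cd ▹ vl
table swapK  vl = [] ▹ kt ▹ vl
table swapK  kt = []
table consK  cd = [] ▹ cd ▹ vl
table consK  vl = []
table consK  kt = [] ▹ kt ▹ kt ▹ kt
table loopK  cd = [] ▹ cd ▹ kt
table loopK  vl = [] ▹ vl
table loopK  kt = []
table exitK  cd = [] ▹ kt ▹ cd ▹ vl
table exitK  vl = [] ▹ vl
table exitK  kt = [] ▹ kt ▹ kt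
table againK cd = [] ▹ kt ▹ cd
table againK vl = [] ▹ vl
table againK kt = [] ▹ kt ▹ kt
table brzK   cd = [] ▹ cd ▹ vl
table brzK   vl = [] ▹ kt ▹ vl
table brzK   kt = [] ▹ kt ▹ kt
table brsK   cd = [] ▹ cd ▹ kt
table brsK   vl = [] ▹ kt ▹ vl
table brsK   kt = [] ▹ kt ▹ kt

next : Kind → Tm → Tm
next k t = nd CFG (at (table k cd) t) (at (table k vl) t) (at (table k kt) t)

ValOK : Maybe ℕ → Tm → Set
ValOK nothing  v = ⊤
ValOK (just l) v = T (hasLab l v)

Enabled : Kind → Tm → Set
Enabled k t = T (hasLab (opLab k) (fld t cd)) × ValOK (valLab k) (fld t vl)

data _⟶_ : Tm → Tm → Set where
  step : ∀ k {c v κ} → Enabled k (nd CFG c v κ) → nd CFG c v κ ⟶ next k (nd CFG c v κ)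

_⟶*_ : Tm → Tm → Set
_⟶*_ = Star _⟶_

-- Compilation of partial recursive functions.

data Code : Set where
  stop : ℕ → Code
  one  : ℕ → Code → Code
  two  : ℕ → Code → Code → Code

⌜_⌝ : Code → Tm
⌜ stop l ⌝    = nd l lf lf lf
⌜ one l c ⌝   = nd l lf ⌜ c ⌝ lf
⌜ two l c d ⌝ = nd l lf ⌜ c ⌝ ⌜ d ⌝

-- `PUSH` saves the input for `b`. `SWAP` brings it back and stacks the result of `a`. The record
-- executing `CONS` then has the result of `b` in `vl` and that of `a` in `kt.vl`, so it is the
-- pair.
pairC : (Code → Code) → (Code → Code) → Code → Code
pairC a b c = one PUSH (a (one SWAP (b (one CONS c))))

projC : ∀ {n} → Fin n → Code → Code
projC zero    c = one FST c
projC (suc i) c = one SND (projC i c)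

-- Iterates on states (m, i, r, xs) with m rounds to go and r the value at i.
recInit recUpdate : (Code → Code) → Code → Code
recInit f = pairC (one FST) (pairC (one NIL) (pairC (one SND ∘ f) (one SND)))
recUpdate g = pairC (one FST ∘ one SND)
  (pairC (one SND ∘ one FST ∘ one WRAP) (pairC (one SND ∘ g) (one SND ∘ one SND ∘ one SND)))

-- Code stays a finite tree: `LOOP` stacks its own record, from which `AGAIN` recovers the loop cell
-- and `EXIT` the code after the loop. `BR` tests the counter extracted by `FST` and restores the
-- state saved by `PUSH`.
recLoop : (Code → Code) → Code → Code
recLoop g c = two LOOP (one SND (one SND (one FST c)))
  (one PUSH (one FST (two BR (stop EXIT) (recUpdate g (stop AGAIN)))))

minTest : Code
minTest = one PUSH (one FST (two BR (one SND (stop EXIT))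
  (one SND (pairC (one FST ∘ one WRAP) (one SND) (stop AGAIN)))))

minLoop : (Code → Code) → Code → Code
minLoop f c = two LOOP (one FST c) (pairC f id minTest)

compile  : ∀ {n} → PRF n → Code → Code
compile* : ∀ {n m} → Vec (PRF n) m → Code → Code
compile Z           = one NIL
compile S           = one FST ∘ one WRAP
compile (P i)       = projC i
compile (Comp f gs) = compile* gs ∘ compile f
compile (Rec f g)   = recInit (compile f) ∘ recLoop (compile g)
compile (Min f)     = pairC (one NIL) id ∘ minLoop (compile f)
compile* []         = one NIL
compile* (g ∷ gs)   = pairC (compile g) (compile* gs)

-- Correctness of the compiled code.

fstT sndT : Tm → Tm
fstT t = fld (fld t kt) vl
sndT t = fld t vl

-- A predicate instead of a canonical term, since a successor made by `WRAP` is a whole record that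
-- also drags code and stack along.
data IsNum (t : Tm) : ℕ → Set where
  zeroN : T (hasLab NIL t) → IsNum t zero
  sucN  : ∀ {n} → T (hasLab CFG t) → IsNum (sndT t) n → IsNum t (suc n)

zero-label : ∀ {t} → IsNum t zero → T (hasLab NIL t)
zero-label (zeroN l) = l

suc-label : ∀ {t n} → IsNum t (suc n) → T (hasLab CFG t)
suc-label (sucN l _) = l

pred-num : ∀ {t n} → IsNum t (suc n) → IsNum (sndT t) n
pred-num (sucN _ h) = h

data IsEnv (t : Tm) : ∀ {n} → Vec ℕ n → Set where
  []  : IsEnv t []
  _∷_ : ∀ {n x} {xs : Vec ℕ n} → IsNum (fstT t) x → IsEnv (sndT t) xs → IsEnv t (x ∷ xs)

headE : ∀ {t n x} {xs : Vec ℕ n} → IsEnv t (x ∷ xs) → IsNum (fstT t) x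
headE (h ∷ _) = h

tailE : ∀ {t n x} {xs : Vec ℕ n} → IsEnv t (x ∷ xs) → IsEnv (sndT t) xs
tailE (_ ∷ e) = e

⟨_,_,_⟩ : Code → Tm → Tm → Tm
⟨ c , v , κ ⟩ = nd CFG ⌜ c ⌝ v κ

-- Arbitrary remaining code and stack allow runs to be put in sequence and to be nested between
-- `PUSH` and `CONS` or inside loops.
record Does (a : Code → Code) (v : Tm) (Q : Tm → Set) : Set where
  constructor does
  field exec : ∀ c κ → Σ Tm λ w → Q w × ⟨ a c , v , κ ⟩ ⟶* ⟨ c , w , κ ⟩
open Does

private variable
  a b : Code → Code
  v : Tm
  Q R : Tm → Set

does-id : Q v → Does id v Q
does-id q .exec c κ = _ , q , ε

does-∘ : Does a v Q → (∀ {w} → Q w → Does b w R) → Does (a ∘ b) v R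
does-∘ {b = b} da db .exec c κ =
  let w , q , s = da .exec (b c) κ ; u , r , s' = db q .exec c κ in u , r , s ◅◅ s'

-- The zero produced is the instruction cell itself, by its label `NIL`.
does-nil : Does (one NIL) v (λ w → IsNum w 0)
does-nil .exec c κ = _ , zeroN tt , step nilK (tt , tt) ◅ ε

does-suc : ∀ {n} → IsNum v n → Does (one WRAP) v (λ w → IsNum w (suc n))
does-suc iv .exec c κ = _ , sucN tt iv , step wrapK (tt , tt) ◅ ε

does-fst : Q (fstT v) → Does (one FST) v Q
does-fst q .exec c κ = _ , q , step fstK (tt , tt) ◅ ε

does-snd : Q (sndT v) → Does (one SND) v Q
does-snd q .exec c κ = _ , q , step sndK (tt , tt) ◅ ε

does-fst∘ : Does a (fstT v) Q → Does (one FST ∘ a) v Q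
does-fst∘ {v = v} d = does-∘ {Q = _≡ fstT v} (does-fst refl) λ { refl → d }

does-snd∘ : Does a (sndT v) Q → Does (one SND ∘ a) v Q
does-snd∘ {v = v} d = does-∘ {Q = _≡ sndT v} (does-snd refl) λ { refl → d }

does-pair : ∀ {n x} {xs : Vec ℕ n} → Does a v (λ w → IsNum w x) → Does b v (λ w → IsEnv w xs) →
            Does (pairC a b) v (λ w → IsEnv w (x ∷ xs))
does-pair {a} {v} {b = b} da db .exec c κ =
  let κ₁ = ⟨ pairC a b c , v , κ ⟩
      w , q , s = da .exec (one SWAP (b (one CONS c))) κ₁
      κ₂ = ⟨ one SWAP (b (one CONS c)) , w , κ₁ ⟩
      u , r , s' = db .exec (one CONS c) κ₂
  in _ , q ∷ r , step pushK (tt , tt) ◅ s ◅◅ step swapK (tt , tt) ◅ s' ◅◅ step consK (tt , tt) ◅ ε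

Correct : ∀ {n} → PRF n → Set
Correct f = ∀ {xs y v} → f [ xs ]⇓ y → IsEnv v xs → Does (compile f) v (λ w → IsNum w y)

proj-correct : ∀ {n} (i : Fin n) {xs} → IsEnv v xs → Does (projC i) v (λ w → IsNum w (Vec.lookup xs i))
proj-correct zero    {x ∷ xs} (h ∷ _) = does-fst h
proj-correct (suc i) {x ∷ xs} (_ ∷ e) = does-snd∘ (proj-correct i e)

module _ {n} {f : PRF n} {g : PRF (suc (suc n))} (F : Correct f) (G : Correct g) where

  update-correct : ∀ {s m k r y xs} → IsEnv s (suc m ∷ k ∷ r ∷ xs) → g [ k ∷ r ∷ xs ]⇓ y →
                   Does (recUpdate (compile g)) s (λ w → IsEnv w (m ∷ suc k ∷ y ∷ xs))
  update-correct (im ∷ ik ∷ ir ∷ ixs) d =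
    does-pair (does-fst∘ (does-snd (pred-num im)))
      (does-pair (does-snd∘ (does-fst∘ (does-suc ik)))
        (does-pair (does-snd∘ (G d (ik ∷ ir ∷ ixs))) (does-snd∘ (does-snd∘ (does-snd ixs)))))

  init-correct : ∀ {v m r xs} → f [ xs ]⇓ r → IsEnv v (m ∷ xs) →
                 Does (recInit (compile f)) v (λ w → IsEnv w (m ∷ 0 ∷ r ∷ xs))
  init-correct d (im ∷ ixs) =
    does-pair (does-fst im) (does-pair does-nil (does-pair (does-snd∘ (F d ixs)) (does-snd ixs)))

  rec-round : ∀ {c κ s m k r y xs} → IsEnv s (suc m ∷ k ∷ r ∷ xs) → g [ k ∷ r ∷ xs ]⇓ y →
    Σ Tm λ s' → IsEnv s' (m ∷ suc k ∷ y ∷ xs) ×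
      ⟨ recLoop (compile g) c , s , κ ⟩ ⟶* ⟨ recLoop (compile g) c , s' , κ ⟩
  rec-round {c} {κ} {s} e@(im ∷ _) d =
    let s' , is' , run = update-correct e d .exec (stop AGAIN) ⟨ recLoop (compile g) c , s , κ ⟩
    in s' , is' , step loopK (tt , tt) ◅ step pushK (tt , tt) ◅ step fstK (tt , tt)
         ◅ step brsK (tt , suc-label im) ◅ run ◅◅ step againK (tt , tt) ◅ ε

  -- The derivation is unwound from its last step, while the machine starts at index 0. Leaving `m`
  -- rounds open bridges this: the premise at `k` is applied with `suc m` rounds to go, and one more
  -- round uses one up.
  rec-rounds : ∀ {c κ v m k r xs} → Rec f g [ k ∷ xs ]⇓ r → IsEnv v (m + k ∷ xs) →
    Σ Tm λ s → IsEnv s (m ∷ k ∷ r ∷ xs) ×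
      ⟨ compile (Rec f g) c , v , κ ⟩ ⟶* ⟨ recLoop (compile g) c , s , κ ⟩
  rec-rounds {c} {κ} {m = m} (⇓Rec0 d) (im ∷ ixs) =
    init-correct d (subst (IsNum _) (+-identityʳ m) im ∷ ixs) .exec (recLoop (compile g) c) κ
  rec-rounds {m = m} (⇓RecS {k = k} d d') (im ∷ ixs) =
    let s , is , run = rec-rounds {m = suc m} d (subst (IsNum _) (+-suc m k) im ∷ ixs)
        s' , is' , run' = rec-round is d'
    in s' , is' , run ◅◅ run'

  rec-correct : Correct (Rec f g)
  rec-correct {k ∷ xs} d e .exec c κ =
    let s , is , run = rec-rounds {m = 0} d e
    in _ , headE (tailE (tailE is)) , run ◅◅ step loopK (tt , tt) ◅ step pushK (tt , tt) ◅ step fstK (tt , tt)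
         ◅ step brzK (tt , zero-label (headE is)) ◅ step exitK (tt , tt)
         ◅ step sndK (tt , tt) ◅ step sndK (tt , tt) ◅ step fstK (tt , tt) ◅ ε

advance-correct : ∀ {s n j} {xs : Vec ℕ n} → IsEnv s (j ∷ xs) →
                  Does (pairC (one FST ∘ one WRAP) (one SND)) s (λ w → IsEnv w (suc j ∷ xs))
advance-correct (ij ∷ ixs) = does-pair (does-fst∘ (does-suc ij)) (does-snd ixs)

start-correct : ∀ {v n} {xs : Vec ℕ n} → IsEnv v xs → Does (pairC (one NIL) id) v (λ w → IsEnv w (0 ∷ xs))
start-correct e = does-pair does-nil (does-id e)

module _ {n} {f : PRF (suc n)} (F : Correct f) where

  min-test : ∀ {c κ s j y xs} → f [ j ∷ xs ]⇓ y → IsEnv s (j ∷ xs) →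
    Σ Tm λ w → IsEnv w (y ∷ j ∷ xs) ×
      ⟨ minLoop (compile f) c , s , κ ⟩ ⟶* ⟨ minTest , w , ⟨ minLoop (compile f) c , s , κ ⟩ ⟩
  min-test d e =
    let w , h , run = does-pair (F d e) (does-id e) .exec minTest _
    in w , h , step loopK (tt , tt) ◅ run

  min-rounds : ∀ {c κ s k xs} → IsEnv s (0 ∷ xs) →
    (∀ j → j < k → Σ ℕ λ v → f [ j ∷ xs ]⇓ suc v) →
    Σ Tm λ s' → IsEnv s' (k ∷ xs) ×
      ⟨ minLoop (compile f) c , s , κ ⟩ ⟶* ⟨ minLoop (compile f) c , s' , κ ⟩
  min-rounds {k = zero} e h = _ , e , ε
  min-rounds {c} {κ} {k = suc k} e h =
    let s , e' , run = min-rounds {k = k} e (λ j j<k → h j (<-trans j<k (n<1+n k)))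
        w , is , run' = min-test (proj₂ (h k (n<1+n k))) e'
        s' , is' , run'' = advance-correct (tailE is) .exec (stop AGAIN) ⟨ minLoop (compile f) c , s , κ ⟩
    in s' , is' , run ◅◅ run' ◅◅ step pushK (tt , tt) ◅ step fstK (tt , tt) ◅ step brsK (tt , suc-label (headE is))
         ◅ step sndK (tt , tt) ◅ run'' ◅◅ step againK (tt , tt) ◅ ε

  min-correct : Correct (Min f)
  min-correct (⇓Min d h) e .exec c κ =
    let s₀ , e₀ , run₀ = start-correct e .exec (minLoop (compile f) c) κ
        s , e' , run = min-rounds e₀ h
        w , is , run' = min-test d e'
    in _ , headE (tailE is) , run₀ ◅◅ run ◅◅ run' ◅◅ step pushK (tt , tt) ◅ step fstK (tt , tt)
         ◅ step brzK (tt , zero-label (headE is)) ◅ step sndK (tt , tt) ◅ step exitK (tt , tt) ◅ step fstK (tt , tt) ◅ ε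

compile-correct  : ∀ {n} (f : PRF n) → Correct f
compile*-correct : ∀ {n m} (gs : Vec (PRF n) m) {xs ys v} → gs [ xs ]⇓* ys → IsEnv v xs →
                   Does (compile* gs) v (λ w → IsEnv w ys)
compile-correct Z ⇓Z e = does-nil
compile-correct S ⇓S (h ∷ []) = does-fst∘ (does-suc h)
compile-correct (P i) ⇓P e = proj-correct i e
compile-correct (Comp f gs) (⇓Comp ds d) e = does-∘ (compile*-correct gs ds e) (compile-correct f d)
compile-correct (Rec f g) = rec-correct (compile-correct f) (compile-correct g)
compile-correct (Min f) = min-correct (compile-correct f)
compile*-correct [] [] e .exec c κ = _ , [] , step nilK (tt , tt) ◅ ε
compile*-correct (g ∷ gs) (d ∷ ds) e = does-pair (compile-correct g d e) (compile*-correct gs ds e)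

-- Names of predicates and constants, and the instances.

thrice fourfold : ℕ → ℕ
thrice zero      = zero
thrice (suc n)   = suc (suc (suc (thrice n)))
fourfold zero    = zero
fourfold (suc n) = suc (suc (suc (suc (fourfold n))))

-- Bijective base-three numeration with digits 1, 2, 3, so that every number names exactly one path.
enc : Path → ℕ
enc []       = 0
enc (p ▹ cd) = suc (thrice (enc p))
enc (p ▹ vl) = suc (suc (thrice (enc p)))
enc (p ▹ kt) = suc (suc (suc (thrice (enc p))))

-- Predicate names: nrel p is the complement of rel p, nxt k relates the
-- record created by a step of kind k to its creator, wt i belongs to the
-- selection of the i-th rule.
rel nrel : Path → ℕ
rel p = fourfold (enc p)
nrel p = suc (fourfold (enc p))

kindCode : Kind → ℕ
kindCode nilK   = 0
kindCode wrapK  = 1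
kindCode fstK   = 2
kindCode sndK   = 3
kindCode pushK  = 4
kindCode swapK  = 5
kindCode consK  = 6
kindCode loopK  = 7
kindCode exitK  = 8
kindCode againK = 9
kindCode brzK   = 10
kindCode brsK   = 11

nxt : Kind → ℕ
nxt k = suc (suc (fourfold (kindCode k)))

wt : ℕ → ℕ
wt i = suc (suc (suc (fourfold i)))

pattern SELECTOR = 0
pattern LABEL l  = suc l

labelFact : ℕ → Path → Lit
labelFact l p = posU (LABEL l) (enc p)

edgeFact : Path → Field → Lit
edgeFact p j = posB (rel ([] ▹ j)) (enc p) (enc (p ▹ j))

-- The constant `enc p` stands for the subterm of the initial record at path `p`.
facts  : Path → Tm → List Lit
facts* : Path → Field → Tm → List Lit
facts p lf           = []
facts p (nd l c v k) = labelFact l p ∷ facts* p cd c ++ facts* p vl v ++ facts* p kt k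
facts* p j lf              = []
facts* p j t@(nd _ _ _ _)  = edgeFact p j ∷ facts (p ▹ j) t

main : PRF 1 → Code
main F = pairC id (one NIL) (compile F (stop HALT))

num : ℕ → Tm
num zero    = nd NIL lf lf lf
num (suc n) = nd CFG lf (num n) lf

root : PRF 1 → ℕ → Tm
root F n = ⟨ main F , num n , lf ⟩

numPath : ℕ → Path
numPath zero    = [] ▹ vl
numPath (suc i) = numPath i ▹ vl

progFacts : PRF 1 → List Lit
progFacts F = labelFact CFG [] ∷ edgeFact [] vl ∷ facts* [] cd ⌜ main F ⌝

-- The input is consed in front of the program, so that primitive recursion on `i` computes the code
-- of the whole from the code of `Γ`.
numFacts : ℕ → List Lit → List Lit
numFacts zero    Γ = Γ
numFacts (suc i) Γ = labelFact CFG (numPath i) ∷ edgeFact (numPath i) vl ∷ numFacts i Γ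

withInput : List Lit → ℕ → Instance 0
withInput Γ n = labelFact NIL (numPath n) ∷ numFacts n Γ , []

-- Computing the codes of instances, and diagonalization.

constP : ∀ {n} → ℕ → PRF n
constP zero    = Z
constP (suc c) = Comp S (constP c ∷ [])

succP : ∀ {n} → PRF n → PRF n
succP e = Comp S (e ∷ [])

addP pairP : PRF 2
triP thriceP numPathP : PRF 1
addP     = Rec (P zero) (succP (P (suc zero)))
triP     = Rec Z (Comp addP (succP (P zero) ∷ P (suc zero) ∷ []))
pairP    = Comp addP (Comp triP (addP ∷ []) ∷ P (suc zero) ∷ [])
thriceP  = Rec Z (succP (succP (succP (P (suc zero)))))
-- The constant 2 is the code of `[] ▹ vl`, where the numeral starts.
numPathP = Rec (constP 2) (succP (succP (Comp thriceP (P (suc zero) ∷ []))))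

pairE : ∀ {n} → PRF n → PRF n → PRF n
pairE e e' = Comp pairP (e ∷ e' ∷ [])

private variable
  n : ℕ
  xs : Vec ℕ n

constP-eval : ∀ c → constP c [ xs ]⇓ c
constP-eval zero    = ⇓Z
constP-eval (suc c) = ⇓Comp (constP-eval c ∷ []) ⇓S

succP-eval : ∀ {e a} → e [ xs ]⇓ a → succP e [ xs ]⇓ suc a
succP-eval d = ⇓Comp (d ∷ []) ⇓S

addP-eval : ∀ a {b} → addP [ a ∷ b ∷ [] ]⇓ (a + b)
addP-eval zero    = ⇓Rec0 ⇓P
addP-eval (suc a) = ⇓RecS (addP-eval a) (succP-eval ⇓P)

triP-eval : ∀ a → triP [ a ∷ [] ]⇓ tri a
triP-eval zero    = ⇓Rec0 ⇓Z
triP-eval (suc a) = ⇓RecS (triP-eval a) (⇓Comp (succP-eval ⇓P ∷ ⇓P ∷ []) (addP-eval (suc a)))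

pairE-eval : ∀ {e e' a b} → e [ xs ]⇓ a → e' [ xs ]⇓ b → pairE e e' [ xs ]⇓ pair a b
pairE-eval {a = a} {b} d d' = ⇓Comp (d ∷ d' ∷ [])
  (⇓Comp (⇓Comp (addP-eval a ∷ []) (triP-eval (a + b)) ∷ ⇓P ∷ []) (addP-eval (tri (a + b))))

thriceP-eval : ∀ a → thriceP [ a ∷ [] ]⇓ thrice a
thriceP-eval zero    = ⇓Rec0 ⇓Z
thriceP-eval (suc a) = ⇓RecS (thriceP-eval a) (succP-eval (succP-eval (succP-eval ⇓P)))

numPathP-eval : ∀ i → numPathP [ i ∷ [] ]⇓ enc (numPath i)
numPathP-eval zero    = ⇓Rec0 (constP-eval 2)
numPathP-eval (suc i) = ⇓RecS (numPathP-eval i)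
  (succP-eval (succP-eval (⇓Comp (⇓P ∷ []) (thriceP-eval (enc (numPath i))))))

-- Records, so that Agda compares literals and lists and never the
-- enormous normal forms of their codes.
record EvalLit (e : PRF n) (xs : Vec ℕ n) (x : Lit) : Set where
  field eval : e [ xs ]⇓ codeLit x

record EvalList (e : PRF n) (xs : Vec ℕ n) (Γ : List Lit) : Set where
  constructor mk
  field eval : e [ xs ]⇓ codeList codeLit Γ

record EvalInstance (e : PRF n) (xs : Vec ℕ n) (I : Instance 0) : Set where
  field eval : e [ xs ]⇓ codeInstance I

open EvalLit
open EvalList
open EvalInstance

posUE consE : PRF n → PRF n → PRF n
posUE e e' = pairE (constP 0) (pairE e e')
consE e e' = succP (pairE e e')

posBE : PRF n → PRF n → PRF n → PRF n
posBE e e' e'' = pairE (constP 2) (pairE e (pairE e' e''))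

posUE-eval : ∀ {e e' p a} → e [ xs ]⇓ p → e' [ xs ]⇓ a → EvalLit (posUE e e') xs (posU p a)
posUE-eval d d' .eval = pairE-eval (constP-eval 0) (pairE-eval d d')

posBE-eval : ∀ {e e' e'' p a b} → e [ xs ]⇓ p → e' [ xs ]⇓ a → e'' [ xs ]⇓ b →
             EvalLit (posBE e e' e'') xs (posB p a b)
posBE-eval d d' d'' .eval = pairE-eval (constP-eval 2) (pairE-eval d (pairE-eval d' d''))

consE-eval : ∀ {e e' x Γ} → EvalLit e xs x → EvalList e' xs Γ → EvalList (consE e e') xs (x ∷ Γ)
consE-eval d d' .eval = succP-eval (pairE-eval (d .eval) (d' .eval))

instance-eval : ∀ {e Γ} → EvalList e xs Γ → EvalInstance (pairE e Z) xs (Γ , [])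
instance-eval d .eval = pairE-eval (d .eval) ⇓Z

numFactsP : PRF 2
numFactsP = Rec (P zero)
  (consE (posUE (constP (LABEL CFG)) q) (consE (posBE (constP (rel ([] ▹ vl))) q q') (P (suc zero))))
  where
  q q' : PRF 3
  q  = Comp numPathP (P zero ∷ [])
  q' = Comp numPathP (succP (P zero) ∷ [])

numFactsP-eval : ∀ i N Γ → N ≡ codeList codeLit Γ →
                 EvalList numFactsP (i ∷ N ∷ []) (numFacts i Γ)
numFactsP-eval zero N Γ refl .eval    = ⇓Rec0 ⇓P
numFactsP-eval (suc i) N Γ eq .eval = ⇓RecS (numFactsP-eval i N Γ eq .eval)
  (consE-eval
    (posUE-eval (constP-eval (LABEL CFG)) (⇓Comp (⇓P ∷ []) (numPathP-eval i)))
    (consE-eval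
      (posBE-eval (constP-eval (rel ([] ▹ vl))) (⇓Comp (⇓P ∷ []) (numPathP-eval i))
        (⇓Comp (succP-eval ⇓P ∷ []) (numPathP-eval (suc i))))
      (mk ⇓P)) .eval)

-- The self-application: the one argument serves both as the code of the program facts and as the
-- input whose numeral is added to them.
selfInputP : PRF 1
selfInputP = pairE
  (consE (posUE (constP (LABEL NIL)) numPathP) (Comp numFactsP (P zero ∷ P zero ∷ []))) Z

selfInputP-eval : ∀ N Γ → N ≡ codeList codeLit Γ → EvalInstance selfInputP (N ∷ []) (withInput Γ N)
selfInputP-eval N Γ eq = instance-eval
  (consE-eval (posUE-eval (constP-eval (LABEL NIL)) (numPathP-eval N))
    (mk (⇓Comp (⇓P ∷ ⇓P ∷ []) (numFactsP-eval N N Γ eq .eval))))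

-- The diagonal argument: a decider d would have to misjudge the program
-- that applies d to the instance describing that program run on its own code.
undecidable : ∀ {ℓ} (Pr : Instance 0 → Set ℓ) →
  (∀ F n → F [ n ∷ [] ]⇓ 0 → Pr (withInput (progFacts F) n)) →
  (∀ F n → F [ n ∷ [] ]⇓ 1 → ¬ Pr (withInput (progFacts F) n)) →
  Undecidable Pr
undecidable Pr ifZero ifOne (d , decides) = contra (codeList codeLit Γ) refl
  where
  F = Comp d (selfInputP ∷ [])
  Γ = progFacts F
  contra : ∀ N → N ≡ codeList codeLit Γ → ⊥
  contra N eq =
    [ (λ (one⇓ , pr)   → ifOne F N (⇓Comp (selfInputP-eval N Γ eq .eval ∷ []) one⇓) pr)
    , (λ (zero⇓ , ¬pr) → ¬pr (ifZero F N (⇓Comp (selfInputP-eval N Γ eq .eval ∷ []) zero⇓)))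
    ]′ (decides (withInput Γ N))

main-correct : ∀ {F n y} → F [ n ∷ [] ]⇓ y → ∀ {v} → IsNum v n → ∀ κ →
  Σ Tm λ w → IsNum w y × ⟨ main F , v , κ ⟩ ⟶* ⟨ stop HALT , w , κ ⟩
main-correct {F} d iv = does-∘ {a = pairC id (one NIL)} {b = compile F} (does-pair (does-id iv) (compile*-correct [] [] []))
  (compile-correct F d) .Does.exec (stop HALT)

-- The rules, the sentence and the query.

fields : List Field
fields = cd ∷ vl ∷ kt ∷ []

∈-fields : ∀ j → j ∈ fields
∈-fields cd = here refl
∈-fields vl = there (here refl)
∈-fields kt = there (there (here refl))

kinds : List Kind
kinds = nilK ∷ wrapK ∷ fstK ∷ sndK ∷ pushK ∷ swapK ∷ consK ∷ loopK ∷ exitK ∷ againK ∷ brzK ∷ brsK ∷ []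

∈-kinds : ∀ k → k ∈ kinds
∈-kinds nilK   = here refl
∈-kinds wrapK  = there (here refl)
∈-kinds fstK   = there (there (here refl))
∈-kinds sndK   = there (there (there (here refl)))
∈-kinds pushK  = there (there (there (there (here refl))))
∈-kinds swapK  = there (there (there (there (there (here refl)))))
∈-kinds consK  = there (there (there (there (there (there (here refl))))))
∈-kinds loopK  = there (there (there (there (there (there (there (here refl)))))))
∈-kinds exitK  = there (there (there (there (there (there (there (there (here refl))))))))
∈-kinds againK = there (there (there (there (there (there (there (there (there (here refl)))))))))
∈-kinds brzK   = there (there (there (there (there (there (there (there (there (there (here refl))))))))))
∈-kinds brsK   = there (there (there (there (there (there (there (there (there (there (there (here refl)))))))))))

-- A rule ρ stands for  left ρ (x , y) ∧ right ρ (y , z) → rel (target ρ) (x , z).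
data Rule : Set where
  extend : Path → Field → Rule
  copy   : Kind → Field → Rule

left right : Rule → ℕ
left  (extend p j) = rel p
left  (copy k j)   = nxt k
right (extend p j) = rel ([] ▹ j)
right (copy k j)   = rel (table k j)

target : Rule → Path
target (extend p j) = p ▹ j
target (copy k j)   = [] ▹ j

-- Only paths of length at least two have to be composed: a single field is a basic relation, and
-- the empty path is handled by `selfRel`.
prefixRules : Path → List Rule
prefixRules []                = []
prefixRules ([] ▹ _)          = []
prefixRules (p@(_ ▹ _) ▹ j)   = extend p j ∷ prefixRules p

fieldRules : Kind → Field → List Rule
fieldRules k j = copy k j ∷ prefixRules (table k j)

rules : List Rule
rules = concatMap (λ k → concatMap (fieldRules k) fields) kinds

∈-rules : ∀ {ρ} k j → ρ ∈ fieldRules k j → ρ ∈ rules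
∈-rules k j ρ∈ = ∈-concatMap⁺ (λ k → concatMap (fieldRules k) fields)
  (lose (∈-kinds k) (∈-concatMap⁺ (fieldRules k) (lose (∈-fields j) ρ∈)))

⋀ : {A : Set} → List A → (A → Fml) → Fml
⋀ []       f = tt
⋀ (x ∷ xs) f = conj (f x) (⋀ xs f)

module _ {A : Set} {M : Structure} {ρ : Var2 → D M} {f : A → Fml} where

  ⋀-elim : ∀ {xs x} → Sat M ρ (⋀ xs f) → x ∈ xs → Sat M ρ (f x)
  ⋀-elim (h , _) (here refl) = h
  ⋀-elim (_ , h) (there x∈)  = ⋀-elim h x∈

  ⋀-intro : ∀ xs → (∀ {x} → x ∈ xs → Sat M ρ (f x)) → Sat M ρ (⋀ xs f)
  ⋀-intro []       h = id
  ⋀-intro (x ∷ xs) h = h (here refl) , ⋀-intro xs (h ∘ there)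

-- A single conjunctive query that acts as the disjunction of the violations
-- of all rules: for every i there is a selector at which wt i points to all
-- records, whereas each other wt j points to a dummy violating rule j.
module Encoding (rs : List Rule) where

  r : ℕ
  r = length rs

  selected : (i j : Fin r) → Dec (i ≡ j) → Fml
  selected i j (yes _) = all vy (impl (un (LABEL CFG) vy) (bin (wt (toℕ j)) vx vy))
  selected i j (no _)  = ex vy (conj (bin (wt (toℕ j)) vx vy)
    (conj (bin (left (lookup rs j)) vy vy)
      (conj (bin (right (lookup rs j)) vy vy) (bin (nrel (target (lookup rs j))) vy vy))))

  selector : Fin r → Fml
  selector i = ex vx (conj (un SELECTOR vx) (⋀ (allFin r) λ j → selected i j (i ≟ j)))

  -- The query is positive, so failure of a target must be witnessed by the predicate `nrel`. Only
  -- exhaustiveness is imposed, as the dummy of the countermodel satisfies both predicates.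
  total : Rule → Fml
  total ρ = all vx (all vy (disj (bin (rel (target ρ)) vx vy) (bin (nrel (target ρ)) vx vy)))

  -- Substitute for equality, so that the entries `[]` of `table` can copy the old record itself.
  selfRel : Fml
  selfRel = all vx (impl (un (LABEL CFG) vx) (bin (rel []) vx vx))

  fieldHas : Field → ℕ → Fml
  fieldHas j l = ex vy (conj (bin (rel ([] ▹ j)) vx vy) (un (LABEL l) vy))

  valueTest : Maybe ℕ → Fml
  valueTest nothing  = tt
  valueTest (just l) = fieldHas vl l

  progress : Kind → Fml
  progress k = all vx (impl (conj (fieldHas cd (opLab k)) (valueTest (valLab k)))
    (ex vy (conj (bin (nxt k) vy vx) (un (LABEL CFG) vy))))

  noZeroHalt : Fml
  noZeroHalt = all vx (neg (conj (fieldHas cd HALT) (fieldHas vl NIL)))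

  φ : Fml
  φ = conj (⋀ (allFin r) selector) (conj (⋀ rs total)
        (conj selfRel (conj (⋀ kinds progress) noZeroHalt)))

  -- The rules share the selector `qx zero`, but each has three variables of its own, so the
  -- violations can be matched independently.
  var : Fin r → Fin 3 → QVar (suc (r * 3)) 0
  var i a = qx (suc (combine i a))

  violation : Fin r → List (QAtom (suc (r * 3)) 0)
  violation i =
      qbin (wt (toℕ i)) (qx zero) (var i zero)
    ∷ qbin (left (lookup rs i)) (var i zero) (var i (suc zero))
    ∷ qbin (right (lookup rs i)) (var i (suc zero)) (var i (suc (suc zero)))
    ∷ qbin (nrel (target (lookup rs i))) (var i zero) (var i (suc (suc zero)))
    ∷ []

  ψ : CQ 0
  ψ = mkCQ (suc (r * 3)) (qun SELECTOR (qx zero)) (concat (tabulate violation))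

∧-intro : ∀ {a b} → T a → T b → T (a ∧ b)
∧-intro {true} _ tb = tb

closed-⋀ : ∀ {A : Set} {b} (xs : List A) {f : A → Fml} →
           (∀ x → T (closedUnder b (f x))) → T (closedUnder b (⋀ xs f))
closed-⋀ []       h = tt
closed-⋀ (x ∷ xs) h = ∧-intro (h x) (closed-⋀ xs h)

module _ (rs : List Rule) where
  open Encoding rs

  φ-closed : IsSentence φ
  φ-closed = ∧-intro (closed-⋀ (allFin r) λ i → closed-⋀ (allFin r) λ j → selected-closed i j (i ≟ j))
    (∧-intro (closed-⋀ rs λ _ → tt) (∧-intro
      (closed-⋀ {b = λ _ → false} kinds {f = progress} λ k → value-closed (valLab k)) tt))
    where
    selected-closed : ∀ i j eq → T (closedUnder (λ w → (w == vx) ∨ false) (selected i j eq))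
    selected-closed i j (yes _) = tt
    selected-closed i j (no _)  = tt
    value-closed : ∀ m → T (closedUnder (λ w → (w == vx) ∨ false) (valueTest m) ∧ true)
    value-closed nothing  = tt
    value-closed (just _) = tt

-- Existence is read classically, so each dummy is available only under a double negation; finitely
-- many of them can still be collected.
¬¬-choice : ∀ {n} {P : Fin n → Set} → (∀ i → ¬ ¬ P i) → ¬ ¬ (∀ i → P i)
¬¬-choice {zero}  h ¬all = ¬all λ ()
¬¬-choice {suc n} h ¬all = h zero λ p → ¬¬-choice (h ∘ suc) λ ps → ¬all λ { zero → p ; (suc i) → ps i }

-- Models without a match of the query follow the machine.

module Models (M : Structure) where

  HasLabel : ℕ → D M → Set
  HasLabel l d = T (U M (LABEL l) d)

  Edge : ℕ → D M → D M → Set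
  Edge b x y = T (B M b x y)

  -- One-sided: the element has at least the labels and edges of the term, possibly more. Uniqueness
  -- of fields could not be expressed without equality or counting.
  data Repr  : D M → Tm → Set
  data Repr* (b : ℕ) (d : D M) : Tm → Set
  data Repr where
    nd : ∀ {d l c v k} → HasLabel l d → Repr* (rel ([] ▹ cd)) d c → Repr* (rel ([] ▹ vl)) d v →
         Repr* (rel ([] ▹ kt)) d k → Repr d (nd l c v k)
  data Repr* b d where
    lf : Repr* b d lf
    to : ∀ {t} e → Edge b d e → Repr e t → Repr* b d t

  repr-field : ∀ {d t} → Repr d t → ∀ j → Repr* (rel ([] ▹ j)) d (fld t j)
  repr-field (nd _ c v k) cd = c
  repr-field (nd _ c v k) vl = v
  repr-field (nd _ c v k) kt = k

  map-repr : ∀ {b b' d d' t} → (∀ {e} → Edge b d e → Edge b' d' e) → Repr* b d t → Repr* b' d' t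
  map-repr f lf          = lf
  map-repr f (to e de r) = to e (f de) r

  repr-label : ∀ {d l t} → Repr d t → T (hasLab l t) → HasLabel l d
  repr-label {l = l} (nd {l = l'} h _ _ _) eq = subst (λ l → HasLabel l _) (sym (≡ᵇ⇒≡ l l' eq)) h

  -- The guard on `x` is there because the sentence makes a selector point only to elements labelled
  -- `CFG`.
  Rule-holds : Rule → Set
  Rule-holds ρ = ∀ {x y z} → HasLabel CFG x → Edge (left ρ) x y → Edge (right ρ) y z →
                 Edge (rel (target ρ)) x z

  module _ (rs : List Rule) where

    open Encoding rs hiding (φ; ψ)

    Matches : Fin r → D M → (Fin 3 → D M) → Set
    Matches i s e = Edge (wt (toℕ i)) s (e zero) × Edge (left (lookup rs i)) (e zero) (e (suc zero))
      × Edge (right (lookup rs i)) (e (suc zero)) (e (suc (suc zero)))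
      × Edge (nrel (target (lookup rs i))) (e zero) (e (suc (suc zero)))

    triple : D M → D M → D M → Fin 3 → D M
    triple x y z zero             = x
    triple x y z (suc zero)       = y
    triple x y z (suc (suc zero)) = z

    query-match : ∀ s → T (U M SELECTOR s) → (∀ i → Σ (Fin 3 → D M) (Matches i s)) →
                  SatCQ M (Encoding.ψ rs) []
    query-match s hs w ¬match = ¬match (e , hs , concat⁺ (tabulate⁺ atoms))
      where
      e : Fin (suc (r * 3)) → D M
      e zero    = s
      e (suc q) = let i , a = remQuot 3 q in proj₁ (w i) a
      e-var : ∀ i a → proj₁ (w i) a ≡ e (suc (combine i a))
      e-var i a = cong (λ p → proj₁ (w (proj₁ p)) (proj₂ p)) (sym (remQuot-combine i a))
      atoms : ∀ i → All (SatQAtom M (valQ M e [])) (violation i)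
      atoms i with w₁ , w₂ , w₃ , w₄ ← proj₂ (w i) =
          subst (Edge _ s) (e-var i _) w₁ ∷ edge w₂ ∷ edge w₃ ∷ edge w₄ ∷ []
        where
        edge : ∀ {b a a'} → Edge b (proj₁ (w i) a) (proj₁ (w i) a') →
               Edge b (e (suc (combine i a))) (e (suc (combine i a')))
        edge {b} {a} {a'} h = subst (λ x → Edge b x (e (suc (combine i a')))) (e-var i a) (subst (Edge b (proj₁ (w i) a)) (e-var i a') h)

    -- If the conclusion of rule `i` failed at `x`, `z`, then `nrel` would hold there. At a selector
    -- for `i`, the elements `x`, `y`, `z` would match the part of rule `i` and the dummies all
    -- other parts, so the query would hold.
    rule-holds : M ⊨ Encoding.φ rs → ¬ SatCQ M (Encoding.ψ rs) [] → ∀ i → Rule-holds (lookup rs i)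
    rule-holds (selectors , totals , _) noQuery i {x} {y} {z} hx exy eyz =
      decidable-stable (T? _) λ ¬exz →
      ⋀-elim {f = total} totals (∈-lookup {xs = rs} i) x z
        (¬exz , λ n → ⋀-elim {f = selector} selectors (∈-allFin i) λ s → λ (hs , sel) →
          ¬¬-choice (λ j → matches n (i ≟ j) (⋀-elim {f = λ j → selected i j (i ≟ j)} sel (∈-allFin j)))
            λ w → noQuery (query-match s hs w))
      where
      matches : Edge (nrel (target (lookup rs i))) x z → ∀ {s j} (eq : Dec (i ≡ j)) →
                Sat M (update (λ _ → pt M) vx s) (selected i j eq) → ¬ ¬ Σ (Fin 3 → D M) (Matches j s)
      matches n (yes refl) all-rec ¬m = ¬m (triple x y z , all-rec x hx , exy , eyz , n)
      matches n (no _) dummy ¬m = dummy λ d → λ (h₁ , h₂ , h₃ , h₄) → ¬m (triple d d d , h₁ , h₂ , h₃ , h₄)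

    ∈-rule-holds : M ⊨ Encoding.φ rs → ¬ SatCQ M (Encoding.ψ rs) [] → ∀ {ρ} → ρ ∈ rs → Rule-holds ρ
    ∈-rule-holds sat noQuery ρ∈ = subst Rule-holds (sym (lookup-index ρ∈)) (rule-holds sat noQuery (index ρ∈))

  facts-repr  : ∀ p {l a b e} → All (SatLit M) (facts p (nd l a b e)) → Repr (c M (enc p)) (nd l a b e)
  facts*-repr : ∀ p j t → All (SatLit M) (facts* p j t) → Repr* (rel ([] ▹ j)) (c M (enc p)) t
  facts-repr p {l} {a} {b} {e} (h ∷ hs) = nd h
    (facts*-repr p cd a (++⁻ˡ (facts* p cd a) hs))
    (facts*-repr p vl b (++⁻ˡ (facts* p vl b) (++⁻ʳ (facts* p cd a) hs)))
    (facts*-repr p kt e (++⁻ʳ (facts* p vl b) (++⁻ʳ (facts* p cd a) hs)))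
  facts*-repr p j lf             hs       = lf
  facts*-repr p j t@(nd _ _ _ _) (h ∷ hs) = to (c M (enc (p ▹ j))) h (facts-repr (p ▹ j) hs)

  -- Climbs from the innermost zero to the whole numeral, consuming the input facts and leaving
  -- those of the program.
  num-repr : ∀ i {j N Γ} → i + j ≡ N → All (SatLit M) (numFacts i Γ) →
             Repr (c M (enc (numPath i))) (num j) → Repr (c M (enc (numPath 0))) (num N) × All (SatLit M) Γ
  num-repr zero    refl hs       rep = rep , hs
  num-repr (suc i) eq (h ∷ h' ∷ hs) rep =
    num-repr i (trans (+-suc i _) eq) hs (nd h lf (to _ h' rep) lf)

  root-repr : ∀ F n → M ⊨Δ proj₁ (withInput (progFacts F) n) → Repr (c M 0) (root F n)
  root-repr F n (h ∷ hs) with num-repr n (+-identityʳ n) hs (nd h lf lf lf)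
  ... | rep , label ∷ edge ∷ code = nd label (facts*-repr [] cd ⌜ main F ⌝ code) (to _ edge rep) lf

  module _ (sat : M ⊨ Encoding.φ rules) (noQuery : ¬ SatCQ M (Encoding.ψ rules) []) where

    open Encoding rules using (progress)

    fieldRule : ∀ {ρ} k j → ρ ∈ fieldRules k j → Rule-holds ρ
    fieldRule k j ρ∈ = ∈-rule-holds rules sat noQuery (∈-rules k j ρ∈)

    selfEdge : ∀ {d} → HasLabel CFG d → Edge (rel []) d d
    selfEdge = let _ , _ , self , _ = sat in self _

    progresses : ∀ k → Sat M (λ _ → pt M) (progress k)
    progresses k = let _ , _ , _ , pr , _ = sat in ⋀-elim {f = progress} pr (∈-kinds k)

    extend-repr : ∀ {p j d s} → HasLabel CFG d → Rule-holds (extend p j) →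
                  Repr* (rel p) d s → Repr* (rel (p ▹ j)) d (fld s j)
    extend-repr h ρ lf = lf
    extend-repr {j = j} h ρ (to e de re) = map-repr (ρ h de) (repr-field re j)

    path-repr : ∀ {d t} p → HasLabel CFG d → Repr d t → All Rule-holds (prefixRules p) → Repr* (rel p) d (at p t)
    path-repr []              h rep _        = to _ (selfEdge h) rep
    path-repr ([] ▹ j)        h rep _        = repr-field rep j
    path-repr (p@(_ ▹ _) ▹ j) h rep (ρ ∷ ρs) = extend-repr h ρ (path-repr p h rep ρs)

    field-has : ∀ {b d s l} → Repr* b d s → T (hasLab l s) → ¬ (∀ y → ¬ (Edge b d y × HasLabel l y))
    field-has (to e de r) h none = none e (de , repr-label r h)

    value-test : ∀ m {d v} → Repr* (rel ([] ▹ vl)) d v → ValOK m v →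
                 Sat M (update (λ _ → pt M) vx d) (Encoding.valueTest rules m)
    value-test nothing  rv _ = id
    value-test (just l) rv h = field-has rv h

    -- `progress` yields a successor. For each of its fields, the prefix rules first trace the path
    -- from `d`, and the copy rule then transfers the end of that path.
    simulate : ∀ {t u d} → t ⟶ u → Repr d t → ¬ ¬ Σ (D M) λ d' → Repr d' u
    simulate {d = d} (step k (hc , hv)) rep@(nd hd rc rv _) ¬rep =
      progresses k d (field-has rc hc , value-test (valLab k) rv hv) λ d' → λ (n , h) →
        let field-repr = λ j → map-repr (fieldRule k j (here refl) h n)
              (path-repr (table k j) hd rep (All.tabulate (fieldRule k j ∘ there)))
        in ¬rep (d' , nd h (field-repr cd) (field-repr vl) (field-repr kt))

    simulate* : ∀ {t u d} → t ⟶* u → Repr d t → ¬ ¬ Σ (D M) λ d' → Repr d' u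
    simulate* ε        rep ¬rep = ¬rep (_ , rep)
    simulate* (s ◅ ss) rep ¬rep = simulate s rep λ (_ , rep') → simulate* ss rep' ¬rep

    no-zero-halt : ∀ {d w κ} → Repr d ⟨ stop HALT , w , κ ⟩ → ¬ IsNum w 0
    no-zero-halt (nd _ rc rv _) (zeroN h) =
      let _ , _ , _ , _ , bad = sat in bad _ (field-has rc tt , field-has rv h)

num-isNum : ∀ n → IsNum (num n) n
num-isNum zero    = zeroN tt
num-isNum (suc n) = sucN tt (num-isNum n)

-- A model without a match would follow the run to a record halting with zero, which `noZeroHalt`
-- excludes.
zero-entails : ∀ F n → F [ n ∷ [] ]⇓ 0 → Qprob (Encoding.φ rules) (Encoding.ψ rules) (withInput (progFacts F) n)
zero-entails F n d M hΔ sat noMatch =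
  let w , isZero , run = main-correct d (num-isNum n) lf
  in simulate* sat noQuery run (root-repr F n hΔ) λ (_ , rep) → no-zero-halt sat noQuery rep isZero
  where
  open Models M
  noQuery : ¬ SatCQ M (Encoding.ψ rules) []
  noQuery q = q noMatch

-- Decoding of names.

incr : Path → Path
incr []       = [] ▹ cd
incr (p ▹ cd) = p ▹ vl
incr (p ▹ vl) = p ▹ kt
incr (p ▹ kt) = incr p ▹ cd

dec : ℕ → Path
dec zero    = []
dec (suc n) = incr (dec n)

-- Three increments bring the last digit back to `cd` and carry one to the rest.
dec-thrice : ∀ n → dec (suc (thrice n)) ≡ dec n ▹ cd
dec-thrice zero    = refl
dec-thrice (suc n) rewrite dec-thrice n = refl

dec-enc : ∀ p → dec (enc p) ≡ p
dec-enc [] = refl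
dec-enc (p ▹ cd) rewrite dec-thrice (enc p) | dec-enc p = refl
dec-enc (p ▹ vl) rewrite dec-thrice (enc p) | dec-enc p = refl
dec-enc (p ▹ kt) rewrite dec-thrice (enc p) | dec-enc p = refl

decKind : ℕ → Kind
decKind 0  = nilK
decKind 1  = wrapK
decKind 2  = fstK
decKind 3  = sndK
decKind 4  = pushK
decKind 5  = swapK
decKind 6  = consK
decKind 7  = loopK
decKind 8  = exitK
decKind 9  = againK
decKind 10 = brzK
decKind _  = brsK

decKind-code : ∀ k → decKind (kindCode k) ≡ k
decKind-code nilK   = refl
decKind-code wrapK  = refl
decKind-code fstK   = refl
decKind-code sndK   = refl
decKind-code pushK  = refl
decKind-code swapK  = refl
decKind-code consK  = refl
decKind-code loopK  = refl
decKind-code exitK  = refl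
decKind-code againK = refl
decKind-code brzK   = refl
decKind-code brsK   = refl

divMod4 : ℕ → ℕ × Fin 4
divMod4 0 = 0 , zero
divMod4 1 = 0 , suc zero
divMod4 2 = 0 , suc (suc zero)
divMod4 3 = 0 , suc (suc (suc zero))
divMod4 (suc (suc (suc (suc n)))) = let q , i = divMod4 n in suc q , i

divMod4-fourfold : ∀ n (i : Fin 4) → divMod4 (toℕ i + fourfold n) ≡ (n , i)
divMod4-fourfold zero zero                   = refl
divMod4-fourfold zero (suc zero)             = refl
divMod4-fourfold zero (suc (suc zero))       = refl
divMod4-fourfold zero (suc (suc (suc zero))) = refl
divMod4-fourfold (suc n) zero                   rewrite divMod4-fourfold n zero = refl
divMod4-fourfold (suc n) (suc zero)             rewrite divMod4-fourfold n (suc zero) = refl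
divMod4-fourfold (suc n) (suc (suc zero))       rewrite divMod4-fourfold n (suc (suc zero)) = refl
divMod4-fourfold (suc n) (suc (suc (suc zero))) rewrite divMod4-fourfold n (suc (suc (suc zero))) = refl

_≟ᵗ_ : (s t : Tm) → Dec (s ≡ t)
lf ≟ᵗ lf = yes refl
lf ≟ᵗ nd _ _ _ _ = no λ ()
nd _ _ _ _ ≟ᵗ lf = no λ ()
nd l a b e ≟ᵗ nd l' a' b' e' =
  map′ (λ { (refl , refl , refl , refl) → refl }) (λ { refl → refl , refl , refl , refl })
    (l ℕ.≟ l' ×-dec a ≟ᵗ a' ×-dec b ≟ᵗ b' ×-dec e ≟ᵗ e')

hasLab-unique : ∀ {l l'} t → T (hasLab l t) → T (hasLab l' t) → l ≡ l'
hasLab-unique {l} {l'} (nd m _ _ _) h h' = trans (≡ᵇ⇒≡ l m h) (sym (≡ᵇ⇒≡ l' m h'))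

-- Elements and relations of the countermodel.

data El (r : ℕ) : Set where
  rec : Tm → El r
  sel : Fin r → El r
  dum : El r

module _ {r : ℕ} where

  -- On records these are the graph of `at p` and its exact complement. On the dummy both hold, so
  -- that it violates every rule.
  relSem negSem : Path → El r → El r → Bool
  relSem p (rec t) (rec u) = ⌊ at p t ≟ᵗ u ⌋
  relSem p dum     dum     = true
  relSem _ _       _       = false
  negSem p dum     dum     = true
  negSem p a       b       = not (relSem p a b)

  nxtSem : Kind → El r → El r → Bool
  nxtSem k (rec u) (rec t) = ⌊ u ≟ᵗ next k t ⌋
  nxtSem k dum     dum     = true
  nxtSem _ _       _       = false

  wtSem : ℕ → El r → El r → Bool
  wtSem n (sel i) (rec _) = n ≡ᵇ toℕ i
  wtSem n (sel i) dum     = not (n ≡ᵇ toℕ i)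
  wtSem _ _       _       = false

  binary : ℕ × Fin 4 → El r → El r → Bool
  binary (n , zero)                   = relSem (dec n)
  binary (n , suc zero)               = negSem (dec n)
  binary (n , suc (suc zero))         = nxtSem (decKind n)
  binary (n , suc (suc (suc zero)))   = wtSem n

  Holds : ℕ → El r → El r → Set
  Holds b x y = T (binary (divMod4 b) x y)

  unary : ℕ → El r → Bool
  unary (LABEL l) (rec t) = hasLab l t
  unary SELECTOR  (sel _) = true
  unary _         _       = false

  private variable
    x y z : El r
    s t u : Tm

  holds-rel : ∀ p → Holds (rel p) x y ≡ T (relSem p x y)
  holds-rel p rewrite divMod4-fourfold (enc p) zero | dec-enc p = refl

  holds-nrel : ∀ p → Holds (nrel p) x y ≡ T (negSem p x y)
  holds-nrel p rewrite divMod4-fourfold (enc p) (suc zero) | dec-enc p = refl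

  holds-nxt : ∀ k → Holds (nxt k) x y ≡ T (nxtSem k x y)
  holds-nxt k rewrite divMod4-fourfold (kindCode k) (suc (suc zero)) | decKind-code k = refl

  holds-wt : ∀ n → Holds (wt n) x y ≡ T (wtSem n x y)
  holds-wt n rewrite divMod4-fourfold n (suc (suc (suc zero))) = refl

  coerce : {X Y : Set} → X ≡ Y → X → Y
  coerce refl h = h

  rel-intro : ∀ p → Holds (rel p) (rec t) (rec (at p t))
  rel-intro p = coerce (sym (holds-rel p)) (fromWitness refl)

  rel-elim : ∀ p y → Holds (rel p) (rec t) y → y ≡ rec (at p t)
  rel-elim p (rec u) h = cong rec (sym (toWitness (coerce (holds-rel p) h)))
  rel-elim p (sel _) h = ⊥-elim (coerce (holds-rel p) h)
  rel-elim p dum     h = ⊥-elim (coerce (holds-rel p) h)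

  rel-source : ∀ p x → Holds (rel p) x (rec u) → Σ Tm λ t → x ≡ rec t
  rel-source p (rec t) h = t , refl
  rel-source p (sel _) h = ⊥-elim (coerce (holds-rel p) h)
  rel-source p dum     h = ⊥-elim (coerce (holds-rel p) h)

  nrel-elim : ∀ p → Holds (nrel p) (rec t) (rec u) → at p t ≢ u
  nrel-elim {t} {u} p h with at p t ≟ᵗ u | coerce (holds-nrel p) h
  ... | no ≢ | _ = ≢

  nxt-intro : ∀ k → Holds (nxt k) (rec (next k t)) (rec t)
  nxt-intro k = coerce (sym (holds-nxt k)) (fromWitness refl)

  nxt-elim : ∀ k y → Holds (nxt k) (rec u) y → Σ Tm λ t → y ≡ rec t × u ≡ next k t
  nxt-elim k (rec t) h = t , refl , toWitness (coerce (holds-nxt k) h)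
  nxt-elim k (sel _) h = ⊥-elim (coerce (holds-nxt k) h)
  nxt-elim k dum     h = ⊥-elim (coerce (holds-nxt k) h)

  wt-record : ∀ {l} i y → T (unary (LABEL l) y) → Holds (wt (toℕ i)) (sel i) y
  wt-record i (rec t) h = coerce (sym (holds-wt (toℕ i))) (≡⇒≡ᵇ (toℕ i) (toℕ i) refl)

  wt-dummy : ∀ {i j} → i ≢ j → Holds (wt (toℕ j)) (sel i) dum
  wt-dummy {i} {j} i≢j = coerce (sym (holds-wt (toℕ j))) (T-not λ h → i≢j (sym (toℕ-injective (≡ᵇ⇒≡ (toℕ j) (toℕ i) h))))
    where
    T-not : ∀ {b} → ¬ T b → T (not b)
    T-not {false} _ = tt
    T-not {true} h = h tt

  wt-elim : ∀ i y → Holds (wt (toℕ i)) (sel i) y → Σ Tm λ t → y ≡ rec t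
  wt-elim i (rec t) h = t , refl
  wt-elim i (sel _) h = ⊥-elim (coerce (holds-wt (toℕ i)) h)
  wt-elim i dum     h with toℕ i ≡ᵇ toℕ i | ≡⇒≡ᵇ (toℕ i) (toℕ i) refl | coerce (holds-wt (toℕ i)) h
  ... | true | _ | ()

  label-elim : ∀ {l} x → T (unary (LABEL l) x) → Σ Tm λ t → x ≡ rec t × T (hasLab l t)
  label-elim (rec t) h = t , refl , h

  selector-elim : ∀ x → T (unary SELECTOR x) → Σ (Fin r) λ i → x ≡ sel i
  selector-elim (sel i) _ = i , refl

  rel-total : ∀ p x y → ¬ (¬ Holds (rel p) x y × ¬ Holds (nrel p) x y)
  rel-total p x y (¬h , ¬n) =
    total x y (¬h ∘ coerce (sym (holds-rel p))) (¬n ∘ coerce (sym (holds-nrel p)))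
    where
    not-total : ∀ b → ¬ T b → ¬ T (not b) → ⊥
    not-total true  h _ = h tt
    not-total false _ h = h tt
    total : ∀ x y → ¬ T (relSem p x y) → ¬ T (negSem p x y) → ⊥
    total (rec t) y       = not-total (relSem p (rec t) y)
    total (sel _) y     _ h = h tt
    total dum (rec _)   _ h = h tt
    total dum (sel _)   _ h = h tt
    total dum dum       _ h = h tt

  left-dummy : ∀ ρ → Holds (left ρ) dum dum
  left-dummy (extend p j) = coerce (sym (holds-rel p)) tt
  left-dummy (copy k j)   = coerce (sym (holds-nxt k)) tt

  right-dummy : ∀ ρ → Holds (right ρ) dum dum
  right-dummy (extend p j) = coerce (sym (holds-rel ([] ▹ j))) tt
  right-dummy (copy k j)   = coerce (sym (holds-rel (table k j))) tt

  nrel-dummy : ∀ p → Holds (nrel p) dum dum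
  nrel-dummy p = coerce (sym (holds-nrel p)) tt

  -- Starting at a record, the premises force `y` and `z` to be records, with `z` exactly what the
  -- target path yields; there `nrel` is false.
  rule-sound : ∀ ρ → Holds (left ρ) (rec t) y → Holds (right ρ) y z → ¬ Holds (nrel (target ρ)) (rec t) z
  rule-sound {y = y} {z} (extend p j) h h' n with rel-elim p y h
  ... | refl with rel-elim ([] ▹ j) z h'
  ... | refl = nrel-elim (p ▹ j) n refl
  rule-sound {y = y} {z} (copy k j) h h' n with nxt-elim k y h
  ... | u , refl , refl with rel-elim (table k j) z h'
  ... | refl = nrel-elim ([] ▹ j) n (next-field k j)
    where
    next-field : ∀ k j → fld (next k u) j ≡ at (table k j) u
    next-field k cd = refl
    next-field k vl = refl
    next-field k kt = refl

-- The finite countermodel.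

subterms : Tm → List Tm
subterms lf             = lf ∷ []
subterms (nd l a b e) = nd l a b e ∷ subterms a ++ subterms b ++ subterms e

-- This includes `lf`: every number names a constant, and a path leaving the term ends in `lf`.
self∈ : ∀ t → t ∈ subterms t
self∈ lf           = here refl
self∈ (nd _ _ _ _) = here refl

fld∈ : ∀ t {x} j → x ∈ subterms t → fld x j ∈ subterms t
fld∈ lf             j (here refl) = here refl
fld∈ (nd l a b e) cd (here refl) = there (∈-++⁺ˡ (self∈ a))
fld∈ (nd l a b e) vl (here refl) = there (∈-++⁺ʳ (subterms a) (∈-++⁺ˡ (self∈ b)))
fld∈ (nd l a b e) kt (here refl) = there (∈-++⁺ʳ (subterms a) (∈-++⁺ʳ (subterms b) (self∈ e)))
fld∈ (nd l a b e) j (there x∈) with ∈-++⁻ (subterms a) x∈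
... | inj₁ x∈a = there (∈-++⁺ˡ (fld∈ a j x∈a))
... | inj₂ x∈be with ∈-++⁻ (subterms b) x∈be
...   | inj₁ x∈b = there (∈-++⁺ʳ (subterms a) (∈-++⁺ˡ (fld∈ b j x∈b)))
...   | inj₂ x∈e = there (∈-++⁺ʳ (subterms a) (∈-++⁺ʳ (subterms b) (fld∈ e j x∈e)))

at∈ : ∀ p t → at p t ∈ subterms t
at∈ []      t = self∈ t
at∈ (p ▹ j) t = fld∈ t j (at∈ p t)

ZeroHalt : Tm → Set
ZeroHalt t = T (hasLab HALT (fld t cd)) × T (hasLab NIL (fld t vl))

-- The root paths interpret the constants. Besides selectors and the dummy, the sentence demands
-- only successors of enabled records, hence closure under `next`.
module CounterModel (rs : List Rule) (t₀ : Tm) (ts : List Tm) (at∈ts : ∀ p → at p t₀ ∈ ts)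
  (next∈ts : ∀ {t} k → t ∈ ts → Enabled k t → next k t ∈ ts) (¬halt : ∀ {t} → t ∈ ts → ¬ ZeroHalt t) where

  open Encoding rs

  rest elements : List (El r)
  rest     = map rec ts ++ map sel (allFin r)
  elements = dum ∷ rest

  -- A term listed twice gives two indistinguishable elements, which does no harm in a language
  -- without equality.
  el : Fin (length elements) → El r
  el = lookup elements

  record∈ : ∀ {t} → t ∈ ts → rec t ∈ elements
  record∈ t∈ = there (∈-++⁺ˡ (∈-map⁺ rec t∈))

  selector∈ : ∀ i → sel i ∈ elements
  selector∈ i = there (∈-++⁺ʳ (map rec ts) (∈-map⁺ sel (∈-allFin i)))

  record∈⁻ : ∀ {t} → rec t ∈ elements → t ∈ ts
  record∈⁻ (there t∈) with ∈-++⁻ (map rec ts) t∈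
  ... | inj₁ t∈rec with ∈-map⁻ rec t∈rec
  ...   | _ , u∈ , refl = u∈
  record∈⁻ (there t∈) | inj₂ t∈sel with ∈-map⁻ sel t∈sel
  ...   | _ , _ , ()

  el-record∈ : ∀ d {t} → el d ≡ rec t → t ∈ ts
  el-record∈ d eq = record∈⁻ (subst (_∈ elements) eq (∈-lookup d))

  structure : FinStructure (length rest)
  structure = record
    { U = λ p d → unary p (el d)
    ; B = λ b d e → binary (divMod4 b) (el d) (el e)
    ; c = λ a → index (record∈ (at∈ts (dec a)))
    }

  M : Structure
  M = toStructure structure

  el-const : ∀ p → el (c M (enc p)) ≡ rec (at p t₀)
  el-const p = trans (sym (lookup-index (record∈ (at∈ts (dec (enc p)))))) (cong (λ q → rec (at q t₀)) (dec-enc p))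

  label-true : ∀ p {l t} → at p t₀ ≡ t → T (hasLab l t) → SatLit M (labelFact l p)
  label-true p {l} refl h = subst (λ x → T (unary (LABEL l) x)) (sym (el-const p)) h

  edge-true : ∀ p j → SatLit M (edgeFact p j)
  edge-true p j = subst₂ (Holds (rel ([] ▹ j))) (sym (el-const p)) (sym (el-const (p ▹ j))) (rel-intro ([] ▹ j))

  facts-true  : ∀ p t → at p t₀ ≡ t → All (SatLit M) (facts p t)
  facts*-true : ∀ p j t → at (p ▹ j) t₀ ≡ t → All (SatLit M) (facts* p j t)
  facts-true p lf eq = []
  facts-true p (nd l a b e) eq = label-true p eq (≡⇒≡ᵇ l l refl) ∷
    ++⁺ (facts*-true p cd a (cong (λ t → fld t cd) eq))
      (++⁺ (facts*-true p vl b (cong (λ t → fld t vl) eq)) (facts*-true p kt e (cong (λ t → fld t kt) eq)))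
  facts*-true p j lf             eq = []
  facts*-true p j t@(nd _ _ _ _) eq = edge-true p j ∷ facts-true (p ▹ j) t eq

  has-field : ∀ d {t} j l → el d ≡ rec t →
              Sat M (update (λ _ → pt M) vx d) (fieldHas j l) → T (hasLab l (fld t j))
  has-field d {t} j l eq h = decidable-stable (T? _) λ ¬l → h λ e → λ (edge , label) →
    let e≡ = rel-elim ([] ▹ j) (el e) (subst (λ x → Holds (rel ([] ▹ j)) x (el e)) eq edge)
    in ¬l (subst (λ x → T (unary (LABEL l) x)) e≡ label)

  -- Only records carry labels `LABEL l`, and only records have field edges to records; so no test
  -- of a field succeeds at a selector or at the dummy.
  field-of-record : ∀ d j l → Sat M (update (λ _ → pt M) vx d) (fieldHas j l) →
                    ¬ ¬ Σ Tm λ t → el d ≡ rec t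
  field-of-record d j l h ¬rec = h λ e → λ (edge , label) →
    let u , e≡ , _ = label-elim (el e) label
    in ¬rec (rel-source ([] ▹ j) (el d) (subst (Holds (rel ([] ▹ j)) (el d)) e≡ edge))

  selectors-true : ∀ i → Sat M (λ _ → pt M) (selector i)
  selectors-true i none = none s (subst (T ∘ unary SELECTOR) (sym el-s) tt ,
    ⋀-intro {f = λ j → selected i j (i ≟ j)} (allFin r) (λ {j} _ → selected-true j (i ≟ j)))
    where
    s = index (selector∈ i)
    el-s : el s ≡ sel i
    el-s = sym (lookup-index (selector∈ i))
    selected-true : ∀ j eq → Sat M (update (λ _ → pt M) vx s) (selected i j eq)
    selected-true j (yes refl) d h = subst (λ x → Holds (wt (toℕ i)) x (el d)) (sym el-s) (wt-record i (el d) h)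
    -- Index `zero` is the dummy, the head of `elements`.
    selected-true j (no i≢j) none = none zero
      ( subst (λ x → Holds (wt (toℕ j)) x dum) (sym el-s) (wt-dummy i≢j)
      , left-dummy (lookup rs j) , right-dummy (lookup rs j) , nrel-dummy (target (lookup rs j)))

  self-true : Sat M (λ _ → pt M) selfRel
  self-true d h = let t , eq , _ = label-elim {l = CFG} (el d) h in
    subst₂ (Holds (rel [])) (sym eq) (sym eq) (rel-intro {r} {t} [])

  progress-true : ∀ k → Sat M (λ _ → pt M) (progress k)
  progress-true k d (hc , hv) none = field-of-record d cd (opLab k) hc λ (t , eq) →
    let t'∈ = record∈ (next∈ts k (el-record∈ d eq) (has-field d cd (opLab k) eq hc , value-ok eq (valLab k) hv))
        el-t' = lookup-index t'∈
    in none (index t'∈)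
         ( subst₂ (Holds (nxt k)) el-t' (sym eq) (nxt-intro k)
         , subst (T ∘ unary (LABEL CFG)) el-t' tt)
    where
    value-ok : ∀ {t} → el d ≡ rec t → ∀ m → Sat M (update (λ _ → pt M) vx d) (valueTest m) → ValOK m (fld t vl)
    value-ok eq nothing  _ = tt
    value-ok eq (just l) h = has-field d vl l eq h

  noZeroHalt-true : Sat M (λ _ → pt M) noZeroHalt
  noZeroHalt-true d (hc , hv) = field-of-record d cd HALT hc λ (t , eq) →
    ¬halt (el-record∈ d eq) (has-field d cd HALT eq hc , has-field d vl NIL eq hv)

  φ-true : M ⊨ φ
  φ-true = ⋀-intro {f = selector} (allFin r) (λ {i} _ → selectors-true i)
    , ⋀-intro {f = total} rs (λ {ρ} _ d e → rel-total (target ρ) (el d) (el e))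
    , self-true
    , ⋀-intro {f = progress} kinds (λ {k} _ → progress-true k)
    , noZeroHalt-true

  -- The matched selector is some `sel i`, whose `wt i` reaches records only. So the part of rule
  -- `i` would be a genuine violation among records.
  ψ-false : ¬ SatCQ M ψ []
  ψ-false match = match λ (e , hs , atoms) →
    let i , s≡ = selector-elim (el (e zero)) hs
    in no-violation i s≡ (tabulate⁻ (concat⁻ atoms) i)
    where
    no-violation : ∀ {e : Fin (suc (r * 3)) → D M} i → el (e zero) ≡ sel i →
                   All (SatQAtom M (valQ M e [])) (violation i) → ⊥
    no-violation {e} i s≡ (h₁ ∷ h₂ ∷ h₃ ∷ h₄ ∷ []) =
      let x a = el (e (suc (combine i a)))
          ρ = lookup rs i
          t , x≡ = wt-elim i (x zero) (subst (λ y → Holds (wt (toℕ i)) y (x zero)) s≡ h₁)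
      in rule-sound ρ (subst (λ y → Holds (left ρ) y (x (suc zero))) x≡ h₂) h₃
           (subst (λ y → Holds (nrel (target ρ)) y (x (suc (suc zero)))) x≡ h₄)

-- Determinism and the run with result one.

opKind : ℕ → Tm → Kind
opKind NIL   _ = nilK
opKind WRAP  _ = wrapK
opKind FST   _ = fstK
opKind SND   _ = sndK
opKind PUSH  _ = pushK
opKind SWAP  _ = swapK
opKind CONS  _ = consK
opKind LOOP  _ = loopK
opKind EXIT  _ = exitK
opKind AGAIN _ = againK
opKind _     v = if hasLab NIL v then brzK else brsK

opKind-lab : ∀ k {v} → ValOK (valLab k) v → opKind (opLab k) v ≡ k
opKind-lab nilK   _ = refl
opKind-lab wrapK  _ = refl
opKind-lab fstK   _ = refl
opKind-lab sndK   _ = refl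
opKind-lab pushK  _ = refl
opKind-lab swapK  _ = refl
opKind-lab consK  _ = refl
opKind-lab loopK  _ = refl
opKind-lab exitK  _ = refl
opKind-lab againK _ = refl
opKind-lab brzK {nd NIL _ _ _} _ = refl
opKind-lab brsK {nd CFG _ _ _} _ = refl

-- `opKind` recovers the kind from the instruction label and the value, which avoids comparing all
-- pairs of kinds.
deterministic : ∀ {k k'} t → Enabled k t → Enabled k' t → k ≡ k'
deterministic {k} {k'} t (hc , hv) (hc' , hv') =
  trans (sym (opKind-lab k hv))
    (trans (cong (λ l → opKind l (fld t vl)) (hasLab-unique (fld t cd) hc hc')) (opKind-lab k' hv'))

opLab≢HALT : ∀ k → opLab k ≢ HALT
opLab≢HALT nilK   ()
opLab≢HALT wrapK  ()
opLab≢HALT fstK   ()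
opLab≢HALT sndK   ()
opLab≢HALT pushK  ()
opLab≢HALT swapK  ()
opLab≢HALT consK  ()
opLab≢HALT loopK  ()
opLab≢HALT exitK  ()
opLab≢HALT againK ()
opLab≢HALT brzK   ()
opLab≢HALT brsK   ()

trace : ∀ {t u} → t ⟶* u → List Tm
trace {t} ε        = t ∷ []
trace {t} (_ ◅ ss) = t ∷ trace ss

start∈ : ∀ {t u} (ss : t ⟶* u) → t ∈ trace ss
start∈ ε       = here refl
start∈ (_ ◅ _) = here refl

module _ {w κ : Tm} where

  -- By determinism an enabled step is the one that the run takes, and the last record has none
  -- because its instruction is `HALT`.
  next∈trace : ∀ {t x} (ss : t ⟶* ⟨ stop HALT , w , κ ⟩) k → x ∈ trace ss → Enabled k x → next k x ∈ trace ss
  next∈trace ε k (here refl) (hc , _) = ⊥-elim (opLab≢HALT k (≡ᵇ⇒≡ (opLab k) HALT hc))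
  next∈trace {t} (step k' en' ◅ ss) k (here refl) en with deterministic {k} {k'} t en en'
  ... | refl = there (start∈ ss)
  next∈trace (_ ◅ ss) k (there x∈) en = there (next∈trace ss k x∈ en)

  trace-zeroHalt : ∀ {t x} (ss : t ⟶* ⟨ stop HALT , w , κ ⟩) → x ∈ trace ss → ZeroHalt x → T (hasLab NIL w)
  trace-zeroHalt ε (here refl) (_ , hv) = hv
  trace-zeroHalt {t} (step k (hc , _) ◅ ss) (here refl) (hc' , _) =
    ⊥-elim (opLab≢HALT k (hasLab-unique {opLab k} {HALT} (fld t cd) hc hc'))
  trace-zeroHalt (_ ◅ ss) (there x∈) = trace-zeroHalt ss x∈

-- Holds for all proper subterms of the initial record: although numerals carry the label `CFG`,
-- they contain no instruction, so they neither step nor halt.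
Inert : Tm → Set
Inert t = fld t cd ≡ lf

nd-inert : ∀ {l v k} → All Inert (subterms v) → All Inert (subterms k) → All Inert (subterms (nd l lf v k))
nd-inert hv hk = refl ∷ refl ∷ ++⁺ hv hk

code-inert : ∀ c → All Inert (subterms ⌜ c ⌝)
code-inert (stop l)    = nd-inert (refl ∷ []) (refl ∷ [])
code-inert (one l c)   = nd-inert (code-inert c) (refl ∷ [])
code-inert (two l c d) = nd-inert (code-inert c) (code-inert d)

num-inert : ∀ n → All Inert (subterms (num n))
num-inert zero    = nd-inert (refl ∷ []) (refl ∷ [])
num-inert (suc n) = nd-inert (num-inert n) (refl ∷ [])

module _ (F : PRF 1) (n : ℕ) {w : Tm} (isOne : IsNum w 1) (run : root F n ⟶* ⟨ stop HALT , w , lf ⟩) where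

  ts : List Tm
  ts = subterms (root F n) ++ trace run

  proper-inert : ∀ {t} → t ∈ ts → t ∈ trace run ⊎ Inert t
  proper-inert t∈ with ∈-++⁻ (subterms (root F n)) t∈
  ... | inj₁ (here refl) = inj₁ (start∈ run)
  ... | inj₁ (there t∈') = inj₂ (All.lookup (++⁺ (code-inert (main F)) (++⁺ (num-inert n) (refl ∷ []))) t∈')
  ... | inj₂ t∈trace     = inj₁ t∈trace

  next∈ts : ∀ {t} k → t ∈ ts → Enabled k t → next k t ∈ ts
  next∈ts k t∈ en@(hc , _) with proper-inert t∈
  ... | inj₁ t∈trace = ∈-++⁺ʳ (subterms (root F n)) (next∈trace run k t∈trace en)
  ... | inj₂ inert   = ⊥-elim (subst (T ∘ hasLab (opLab k)) inert hc)

  ¬halt : ∀ {t} → t ∈ ts → ¬ ZeroHalt t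
  ¬halt t∈ z@(hc , _) with proper-inert t∈
  ... | inj₁ t∈trace with () ← hasLab-unique w (suc-label isOne) (trace-zeroHalt run t∈trace z)
  ... | inj₂ inert   = subst (T ∘ hasLab HALT) inert hc

  at-num : ∀ i {j} → i + j ≡ n → at (numPath i) (root F n) ≡ num j
  at-num zero    refl = refl
  at-num (suc i) eq   = cong (λ t → fld t vl) (at-num i (trans (+-suc i _) eq))

  module _ (rs : List Rule) where

    open CounterModel rs (root F n) ts (λ p → ∈-++⁺ˡ (at∈ p (root F n))) next∈ts ¬halt

    numFacts-true : ∀ i {j} → i + j ≡ n → All (SatLit M) (numFacts i (progFacts F))
    numFacts-true zero    _  =
      label-true [] {CFG} refl tt ∷ edge-true [] vl ∷ facts*-true [] cd ⌜ main F ⌝ refl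
    numFacts-true (suc i) eq =
      label-true (numPath i) (at-num i (trans (+-suc i _) eq)) tt ∷ edge-true (numPath i) vl
      ∷ numFacts-true i (trans (+-suc i _) eq)

    input-true : M ⊨Δ proj₁ (withInput (progFacts F) n)
    input-true = label-true (numPath n) (at-num n (+-identityʳ n)) tt ∷ numFacts-true n (+-identityʳ n)

    run-refutes : ¬ FQprob (Encoding.φ rs) (Encoding.ψ rs) (withInput (progFacts F) n)
    run-refutes entails = ψ-false (entails _ structure input-true φ-true)

one-refutes : ∀ rs F n → F [ n ∷ [] ]⇓ 1 →
  ¬ FQprob (Encoding.φ rs) (Encoding.ψ rs) (withInput (progFacts F) n)
one-refutes rs F n d = let w , isOne , run = main-correct d (num-isNum n) lf in run-refutes F n isOne run rs

-- Entailment passes from all models to finite ones. So the zero case, proved for all models, and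
-- the one case, refuted by a finite model, settle both problems with the same sentence and query.
both-undecidable : ∀ rs →
  (∀ F n → F [ n ∷ [] ]⇓ 0 → Qprob (Encoding.φ rs) (Encoding.ψ rs) (withInput (progFacts F) n)) →
  (Σ Fml λ φ → Σ ℕ λ k → Σ (CQ k) λ ψ → IsSentence φ × Undecidable (Qprob φ ψ))
    × (Σ Fml λ φ → Σ ℕ λ k → Σ (CQ k) λ ψ → IsSentence φ × Undecidable (FQprob φ ψ))
both-undecidable rs ifZero =
    (φ , 0 , ψ , φ-closed rs , undecidable (Qprob φ ψ) ifZero
      λ F n d q → one-refutes rs F n d (finite {withInput (progFacts F) n} q))
  , (φ , 0 , ψ , φ-closed rs , undecidable (FQprob φ ψ)
      (λ F n d → finite {withInput (progFacts F) n} (ifZero F n d)) (one-refutes rs))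
  where
  open Encoding rs using (φ; ψ)
  finite : ∀ {I} → Qprob φ ψ I → FQprob φ ψ I
  finite q n structure = q (toStructure structure)

theorem3 : (Σ Fml λ φ → Σ ℕ λ k → Σ (CQ k) λ ψ → IsSentence φ × Undecidable (Qprob φ ψ))
    × (Σ Fml λ φ → Σ ℕ λ k → Σ (CQ k) λ ψ → IsSentence φ × Undecidable (FQprob φ ψ))
theorem3 = both-undecidable rules zero-entails
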